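{- Let \[ (p,r,m)\in\{(5,3,2),\ (7,5,3),\ (11,10,5),\ (17,3,9),\ (19,5,10),\ (23,10,12),\ (29,20,15)\}, \] and let $s$ be an integer with $0\le s<p$ and $s\neq m$. Then for all integers $n\ge0$ and $k\ge1$, we have \[ \mathcal{EO}_u\left( 4 p^{2k}n+4 p^{2k-1}s+ \frac{4 p^{2 k} r+4 p^{2 k-1}m+2 p^2-4 p m-4 r-2}{p^2-1}\right) \equiv 0 \pmod{4}. \]
   Context: For a positive integer $k$, let $f_k:=(q^k;q^k)_\infty=\prod_{i=1}^\infty(1-q^{ki})$. The integers $\mathcal{EO}_u(n)$, $n\ge 0$, are defined by $\sum_{n=0}^\infty \mathcal{EO}_u(n)q^n=\dfrac{f_4^2}{f_2^2}$. -}

module Defs where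

open import Data.Nat using (ℕ; zero; suc; z≤n; s≤s; NonZero)
import Data.Nat as ℕ
import Data.Nat.Properties as ℕ
import Data.Nat.DivMod as ℕ
open import Data.Nat.Tactic.RingSolver using (solve-∀)
open import Data.Bool.Base using (if_then_else_)
open import Data.Fin.Base using (toℕ)
open import Data.List.Base using (List; []; _∷_)
open import Data.List.Membership.Propositional using (_∈_)
open import Data.List.Relation.Unary.Any using (here; there)
open import Data.Product.Base using (∃-syntax; _×_; _,_)
open import Function.Base using (_∘_)
open import Relation.Binary.PropositionalEquality

triples : List (ℕ × ℕ × ℕ)
triples = (5  , 3  , 2)  ∷ (7  , 5  , 3)  ∷ (11 , 10 , 5) ∷ (17 , 3 , 9)
        ∷ (19 , 5  , 10) ∷ (23 , 10 , 12) ∷ (29 , 20 , 15) ∷ []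

p²-1-nonZero : ∀ {p r m} → (p , r , m) ∈ triples → NonZero (p ℕ.^ 2 ℕ.∸ 1)
p²-1-nonZero (here refl) = _
p²-1-nonZero (there (here refl)) = _
p²-1-nonZero (there (there (here refl))) = _
p²-1-nonZero (there (there (there (here refl)))) = _
p²-1-nonZero (there (there (there (there (here refl))))) = _
p²-1-nonZero (there (there (there (there (there (here refl)))))) = _
p²-1-nonZero (there (there (there (there (there (there (here refl))))))) = _

module _ where
  open Data.Nat using (_+_; _*_; _∸_; _^_; _/_; _≤_)

  -- The fraction in the argument of EOᵤ.  Truncated subtraction and floor
  -- division are exact here when p ≥ 2 and k ≥ 1, see offset-exact.
  offset : (p r m k : ℕ) → .{{NonZero (p ℕ.^ 2 ℕ.∸ 1)}} → ℕ
  offset p r m k =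
    (4 * p ^ (2 * k) * r + 4 * p ^ (2 * k ∸ 1) * m + 2 * p ^ 2
       ∸ 4 * p * m ∸ 4 * r ∸ 2) / (p ^ 2 ∸ 1)

  private
    pow : ∀ d j → ∃[ a ] suc d ^ j ≡ 1 + a * d
    pow d zero    = 0 , refl
    pow d (suc j) with pow d j
    ... | a , eq = 1 + a + a * d ,
                   trans (cong (suc d *_) eq) (lemma d a)
      where
      lemma : ∀ d a → suc d * (1 + a * d) ≡ 1 + (1 + a + a * d) * d
      lemma = solve-∀

    p²≡ : ∀ p → 2 ≤ p → p ^ 2 ≡ suc (p ^ 2 ∸ 1)
    p²≡ p 2≤p = sym (ℕ.m+[n∸m]≡n (ℕ.≤-trans (s≤s z≤n) (ℕ.^-monoˡ-≤ 2 2≤p)))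

    p^2j : ∀ p → 2 ≤ p → ∀ j → ∃[ a ] p ^ (2 * j) ≡ 1 + a * (p ^ 2 ∸ 1)
    p^2j p 2≤p j with pow (p ^ 2 ∸ 1) j
    ... | a , eq = a , trans (sym (ℕ.^-*-assoc p 2 j))
                         (trans (cong (_^ j) (p²≡ p 2≤p)) eq)

  offset-exact : ∀ p r m k .{{_ : NonZero (p ^ 2 ∸ 1)}} → 2 ≤ p → 1 ≤ k →
    offset p r m k * (p ^ 2 ∸ 1) + 4 * p * m + 4 * r + 2
      ≡ 4 * p ^ (2 * k) * r + 4 * p ^ (2 * k ∸ 1) * m + 2 * p ^ 2
  offset-exact p r m (suc j) 2≤p _
    with p^2j p 2≤p (suc j) | p^2j p 2≤p j
  ... | a , eqa | b , eqb = begin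
    offset p r m (suc j) * d + 4 * p * m + 4 * r + 2
      ≡⟨ cong (λ z → z * d + 4 * p * m + 4 * r + 2) offset≡ ⟩
    X * d + 4 * p * m + 4 * r + 2
      ≡⟨ num≡ ⟨
    num ∎
    where
    open ≡-Reasoning
    d = p ^ 2 ∸ 1
    X = 4 * r * a + 4 * p * m * b + 2
    num = 4 * p ^ (2 * suc j) * r + 4 * p ^ (2 * suc j ∸ 1) * m + 2 * p ^ 2

    odd≡ : p ^ (2 * suc j ∸ 1) ≡ p * (1 + b * d)
    odd≡ = trans (cong (p ^_) (ℕ.+-suc j (j + 0))) (cong (p *_) eqb)

    expand : ∀ p r m a b d →
      4 * (1 + a * d) * r + 4 * (p * (1 + b * d)) * m + 2 * (1 + d)
        ≡ (4 * r * a + 4 * p * m * b + 2) * d + 4 * p * m + 4 * r + 2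
    expand = solve-∀

    num≡ : num ≡ X * d + 4 * p * m + 4 * r + 2
    num≡ = trans
      (cong₂ _+_ (cong₂ (λ u v → 4 * u * r + 4 * v * m) eqa odd≡)
                 (cong (2 *_) (p²≡ p 2≤p)))
      (expand p r m a b d)

    cancel : ∀ w x y z → w + x + y + z ∸ x ∸ y ∸ z ≡ w
    cancel w x y z = begin
      w + x + y + z ∸ x ∸ y ∸ z   ≡⟨ ℕ.∸-+-assoc (w + x + y + z ∸ x) y z ⟩
      w + x + y + z ∸ x ∸ (y + z) ≡⟨ ℕ.∸-+-assoc (w + x + y + z) x (y + z) ⟩
      w + x + y + z ∸ (x + (y + z)) ≡⟨ cong (_∸ (x + (y + z))) (assoc w x y z) ⟩
      w + (x + (y + z)) ∸ (x + (y + z)) ≡⟨ ℕ.m+n∸n≡m w (x + (y + z)) ⟩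
      w ∎
      where
      assoc : ∀ w x y z → w + x + y + z ≡ w + (x + (y + z))
      assoc = solve-∀

    offset≡ : offset p r m (suc j) ≡ X
    offset≡ = trans
      (cong (_/ d) (trans (cong (λ z → z ∸ 4 * p * m ∸ 4 * r ∸ 2) num≡)
                          (cancel (X * d) (4 * p * m) (4 * r) 2)))
      (ℕ.m*n/n≡m X d)

open import Data.Integer.Base using (ℤ; 0ℤ; 1ℤ; _+_; _-_; -_; _*_)
open import Data.Integer.Properties as ℤ using (+-*-semiring)
open import Algebra.Properties.Semiring.Sum +-*-semiring using (sum⁺-syntax)

-- A formal power series over ℤ in q, given by its coefficients.
Series : Set
Series = ℕ → ℤ

infixl 7 _⊛_ _÷_
infixl 6 _⊝_

q^_ : ℕ → Series
(q^ j) n = if j ℕ.≡ᵇ n then 1ℤ else 0ℤ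

_⊝_ : Series → Series → Series
(f ⊝ g) n = f n - g n

_⊛_ : Series → Series → Series
(f ⊛ g) n = ∑[ i ≤ n ] (f (toℕ i) * g (n ℕ.∸ toℕ i))

-- Long division by a series with constant term 1: with c = g 0, the quotient
-- is c + q · (((g - c f) / q) ÷ f).  See ÷-⊛.
_÷_ : Series → Series → Series
(g ÷ f) zero    = g 0
(g ÷ f) (suc n) = ((λ i → g (suc i) - g 0 * f (suc i)) ÷ f) n

∏[1-q^_·i]_ : ℕ → ℕ → Series
∏[1-q^ k ·i] zero    = q^ 0
∏[1-q^ k ·i] (suc N) = (∏[1-q^ k ·i] N) ⊛ (q^ 0 ⊝ q^ (k ℕ.* suc N))

-- f k = (q^k; q^k)_∞.  For k ≥ 1 the factors with i > n do not affect the
-- coefficient of q^n, see f-stable.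
f : ℕ → Series
f k n = (∏[1-q^ k ·i] n) n

EOᵤ : Series
EOᵤ = (f 4 ⊛ f 4) ÷ (f 2 ⊛ f 2)

÷-⊛ : ∀ g f → f 0 ≡ 1ℤ → (g ÷ f) ⊛ f ≗ g
÷-⊛ g f f₀ zero = begin
  g 0 * f 0 + 0ℤ  ≡⟨ ℤ.+-identityʳ _ ⟩
  g 0 * f 0       ≡⟨ cong (g 0 *_) f₀ ⟩
  g 0 * 1ℤ        ≡⟨ ℤ.*-identityʳ _ ⟩
  g 0             ∎
  where open ≡-Reasoning
÷-⊛ g f f₀ (suc n) = begin
  c * x + (g′ ÷ f ⊛ f) n    ≡⟨ cong (_+_ (c * x)) (÷-⊛ g′ f f₀ n) ⟩
  c * x + (y - c * x)       ≡⟨ cong (_+_ (c * x)) (ℤ.+-comm y (- (c * x))) ⟩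
  c * x + (- (c * x) + y)   ≡⟨ ℤ.+-assoc (c * x) _ y ⟨
  c * x - c * x + y         ≡⟨ cong (_+ y) (ℤ.+-inverseʳ (c * x)) ⟩
  0ℤ + y                    ≡⟨ ℤ.+-identityˡ y ⟩
  y                         ∎
  where
  open ≡-Reasoning
  c = g 0
  x = f (suc n)
  y = g (suc n)
  g′ : Series
  g′ i = g (suc i) - g 0 * f (suc i)

EOᵤ-spec : EOᵤ ⊛ (f 2 ⊛ f 2) ≗ f 4 ⊛ f 4
EOᵤ-spec = ÷-⊛ (f 4 ⊛ f 4) (f 2 ⊛ f 2) refl

private
  -- Multiplication by a series that agrees with 1 up to q^n.
  ⊛-identityʳ-upTo : ∀ (g h : Series) n → (∀ i → i ℕ.≤ n → h i ≡ (q^ 0) i) →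
                     (g ⊛ h) n ≡ g n
  ⊛-identityʳ-upTo g h zero h≈1 = begin
    g 0 * h 0 + 0ℤ  ≡⟨ ℤ.+-identityʳ _ ⟩
    g 0 * h 0       ≡⟨ cong (g 0 *_) (h≈1 0 z≤n) ⟩
    g 0 * 1ℤ        ≡⟨ ℤ.*-identityʳ _ ⟩
    g 0             ∎
    where open ≡-Reasoning
  ⊛-identityʳ-upTo g h (suc n) h≈1 = begin
    g 0 * h (suc n) + ((g ∘ suc) ⊛ h) n
      ≡⟨ cong₂ (λ a b → g 0 * a + b) (h≈1 (suc n) ℕ.≤-refl)
           (⊛-identityʳ-upTo (g ∘ suc) h n (λ i i≤n → h≈1 i (ℕ.m≤n⇒m≤1+n i≤n))) ⟩
    g 0 * 0ℤ + g (suc n)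
      ≡⟨ cong (_+ g (suc n)) (ℤ.*-zeroʳ (g 0)) ⟩
    0ℤ + g (suc n)
      ≡⟨ ℤ.+-identityˡ _ ⟩
    g (suc n) ∎
    where open ≡-Reasoning

  q^-below : ∀ {i j} → i ℕ.< j → (q^ j) i ≡ 0ℤ
  q^-below {zero}  {suc j} _           = refl
  q^-below {suc i} {suc j} (s≤s i<j)   = q^-below i<j

f-stable : ∀ k .{{_ : NonZero k}} n d → (∏[1-q^ k ·i] (d ℕ.+ n)) n ≡ f k n
f-stable k n zero    = refl
f-stable k n (suc d) = trans
  (⊛-identityʳ-upTo (∏[1-q^ k ·i] (d ℕ.+ n)) (q^ 0 ⊝ q^ (k ℕ.* suc (d ℕ.+ n))) n
    (λ i i≤n → trans (cong (λ z → (q^ 0) i - z) (q^-below (small i i≤n)))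
                     (ℤ.+-identityʳ _)))
  (f-stable k n d)
  where
  small : ∀ i → i ℕ.≤ n → i ℕ.< k ℕ.* suc (d ℕ.+ n)
  small i i≤n = ℕ.≤-trans (s≤s (ℕ.≤-trans i≤n (ℕ.m≤n+m n d)))
                          (ℕ.m≤n*m (suc (d ℕ.+ n)) k)

{-# OPTIONS --safe #-}
-- Write w for the argument of EOᵤ.  Modulo 4,
--     f₂² / f₄ = ∏ (1 - 2q^2i / (1 + q^2i)) ≡ 1 + 2 Σ q^2i / (1 - q^2i) = 1 + 2 Σ d(n) q^2n,
-- and d(n) is odd exactly for squares n, so f₂² ≡ f₄ (1 + 2 Σ q^2t²).  Hence
-- f₂⁴ ≡ f₄² and EOᵤ = f₄² / f₂² ≡ f₂².  By the pentagonal number theorem f k is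
-- supported on the k e with 24 e + 1 a square.  The two expressions f₂ f₂ and
-- f₄ (1 + 2 Σ q^2t²) for EOᵤ show that its coefficient at w vanishes modulo 4
-- unless 12 w + 2 is of the form x² + y² and 6 w + 1 is of the form x² + 12 y².
-- Here 6 w + 1 = p^(2k-1) u with p ∤ u, and one of these two forms is
-- anisotropic modulo p: the first for p ≡ 3 (mod 4), the second for
-- p ≡ 2 (mod 3).  An anisotropic form only represents numbers divisible by p to an
-- even power.
module Submission where

open import Defs
open import Data.Nat.Base using (ℕ; _+_; _*_; _∸_; _^_; _≤_; _<_)
open import Data.Integer.Base using (+_)
open import Data.Integer.Divisibility using (_∣_)
open import Data.List.Membership.Propositional using (_∈_)
open import Data.Product.Base using (_,_)
open import Relation.Binary.PropositionalEquality using (_≢_)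

open import Algebra.Bundles using (CommutativeRing)
import Algebra.Solver.Ring
open import Algebra.Solver.Ring.AlmostCommutativeRing
  using (fromCommutativeRing; _-Raw-AlmostCommutative⟶_)
open import Data.Integer.Base using (ℤ; 0ℤ; 1ℤ; +-*-rawRing)
  renaming (_+_ to _+ᶻ_; _*_ to _*ᶻ_; _-_ to _-ᶻ_; -_ to -ᶻ_)
open import Data.Integer.Divisibility.Signed as ∣ using () renaming (_∣_ to _∣ₛ_)
import Data.Integer.Properties as ℤ
import Data.Integer.Tactic.RingSolver as ℤ
open import Data.List.Relation.Unary.Any using (here; there)
open import Data.Maybe.Base using (just; nothing)
open import Data.Nat.Base using (zero; suc; z≤n; s≤s; NonZero; >-nonZero)
import Data.Nat.Divisibility as ℕ
import Data.Nat.DivMod as ℕ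
import Data.Nat.Properties as ℕ
import Data.Nat.Tactic.RingSolver as ℕ
open import Data.Product.Base using (∃-syntax; _×_)
open import Data.Sum.Base using (_⊎_; inj₁; inj₂)
open import Function.Base using (_∘_)
open import Level using (0ℓ)
open import Relation.Binary.Definitions using (WeaklyDecidable)
open import Relation.Binary.PropositionalEquality
  using (_≡_; _≗_; refl; sym; trans; cong; cong₂; subst; module ≡-Reasoning)
open import Relation.Nullary.Decidable
  using (Dec; yes; no; True; toWitness; from-yes; ¬?; _×-dec_; _→-dec_)
open import Relation.Nullary.Negation using (¬_; contradiction)

-- The ring of power series modulo 4 and q^(N+1)

infixl 6 _⊕_
infix  8 ⊖_

_⊕_ : Series → Series → Series
(F ⊕ G) n = F n +ᶻ G n

⊖_ : Series → Series
(⊖ F) n = -ᶻ F n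

const : ℤ → Series
const c zero    = c
const c (suc n) = 0ℤ

0̂ : Series
0̂ _ = 0ℤ

⊛-cong : ∀ {F F′ G G′} → F ≗ F′ → G ≗ G′ → F ⊛ G ≗ F′ ⊛ G′
⊛-cong F≗ G≗ zero    = cong₂ (λ a b → a *ᶻ b +ᶻ 0ℤ) (F≗ 0) (G≗ 0)
⊛-cong F≗ G≗ (suc n) = cong₂ _+ᶻ_ (cong₂ _*ᶻ_ (F≗ 0) (G≗ (suc n)))
                                   (⊛-cong (F≗ ∘ suc) G≗ n)

-- `⊛` unfolds by splitting off the constant term of its left factor only. Splitting one off each
-- factor, with a swap of the shifted factors in between, lowers the index by two; hence the two
-- base cases.
⊛-comm : ∀ F G → F ⊛ G ≗ G ⊛ F
⊛-comm F G zero    = cong (_+ᶻ 0ℤ) (ℤ.*-comm (F 0) (G 0))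
⊛-comm F G (suc zero) = lemma (F 0) (G 1) (F 1) (G 0)
  where
  lemma : ∀ a b c d → a *ᶻ b +ᶻ (c *ᶻ d +ᶻ 0ℤ) ≡ d *ᶻ c +ᶻ (b *ᶻ a +ᶻ 0ℤ)
  lemma = ℤ.solve-∀
⊛-comm F G (suc (suc n)) = begin
  a +ᶻ ((F ∘ suc) ⊛ G) (suc n)           ≡⟨ cong (a +ᶻ_) (⊛-comm (F ∘ suc) G (suc n)) ⟩
  a +ᶻ (b +ᶻ ((G ∘ suc) ⊛ (F ∘ suc)) n) ≡⟨ cong (λ z → a +ᶻ (b +ᶻ z)) (⊛-comm (G ∘ suc) (F ∘ suc) n) ⟩
  a +ᶻ (b +ᶻ ((F ∘ suc) ⊛ (G ∘ suc)) n) ≡⟨ lemma a b _ ⟩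
  b +ᶻ (F ⊛ (G ∘ suc)) (suc n)           ≡⟨ cong (b +ᶻ_) (⊛-comm F (G ∘ suc) (suc n)) ⟩
  b +ᶻ ((G ∘ suc) ⊛ F) (suc n)           ∎
  where
  open ≡-Reasoning
  a = F 0 *ᶻ G (suc (suc n))
  b = G 0 *ᶻ F (suc (suc n))
  lemma : ∀ a b c → a +ᶻ (b +ᶻ c) ≡ b +ᶻ (a +ᶻ c)
  lemma = ℤ.solve-∀

⊛-distribʳ : ∀ F G H → (G ⊕ H) ⊛ F ≗ (G ⊛ F) ⊕ (H ⊛ F)
⊛-distribʳ F G H zero    = lemma (F 0) (G 0) (H 0)
  where
  lemma : ∀ a b c → (b +ᶻ c) *ᶻ a +ᶻ 0ℤ ≡ b *ᶻ a +ᶻ 0ℤ +ᶻ (c *ᶻ a +ᶻ 0ℤ)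
  lemma = ℤ.solve-∀
⊛-distribʳ F G H (suc n) = trans
  (cong ((G ⊕ H) 0 *ᶻ F (suc n) +ᶻ_) (⊛-distribʳ F (G ∘ suc) (H ∘ suc) n))
  (lemma (F (suc n)) (G 0) (H 0) _ _)
  where
  lemma : ∀ a b c d e → (b +ᶻ c) *ᶻ a +ᶻ (d +ᶻ e) ≡ b *ᶻ a +ᶻ d +ᶻ (c *ᶻ a +ᶻ e)
  lemma = ℤ.solve-∀

scale-⊛ : ∀ c G H → (λ n → c *ᶻ G n) ⊛ H ≗ λ n → c *ᶻ (G ⊛ H) n
scale-⊛ c G H zero    = lemma c (G 0) (H 0)
  where
  lemma : ∀ a b c → a *ᶻ b *ᶻ c +ᶻ 0ℤ ≡ a *ᶻ (b *ᶻ c +ᶻ 0ℤ)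
  lemma = ℤ.solve-∀
scale-⊛ c G H (suc n) = trans
  (cong (c *ᶻ G 0 *ᶻ H (suc n) +ᶻ_) (scale-⊛ c (G ∘ suc) H n))
  (lemma c (G 0) (H (suc n)) _)
  where
  lemma : ∀ a b c d → a *ᶻ b *ᶻ c +ᶻ a *ᶻ d ≡ a *ᶻ (b *ᶻ c +ᶻ d)
  lemma = ℤ.solve-∀

-- The shift of `F ⊛ G` is definitionally `F 0` times the shift of `G` plus `(F ∘ suc) ⊛ G`, so
-- distributivity and scaling reduce the claim to `F ∘ suc`.
⊛-assoc : ∀ F G H → (F ⊛ G) ⊛ H ≗ F ⊛ (G ⊛ H)
⊛-assoc F G H zero    = lemma (F 0) (G 0) (H 0)
  where
  lemma : ∀ a b c → (a *ᶻ b +ᶻ 0ℤ) *ᶻ c +ᶻ 0ℤ ≡ a *ᶻ (b *ᶻ c +ᶻ 0ℤ) +ᶻ 0ℤ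
  lemma = ℤ.solve-∀
⊛-assoc F G H (suc n) = begin
  (F 0 *ᶻ G 0 +ᶻ 0ℤ) *ᶻ h +ᶻ (((F ⊛ G) ∘ suc) ⊛ H) n
    ≡⟨ cong ((F 0 *ᶻ G 0 +ᶻ 0ℤ) *ᶻ h +ᶻ_) (⊛-distribʳ H (λ i → F 0 *ᶻ G (suc i)) ((F ∘ suc) ⊛ G) n) ⟩
  (F 0 *ᶻ G 0 +ᶻ 0ℤ) *ᶻ h +ᶻ (((λ i → F 0 *ᶻ G (suc i)) ⊛ H) n +ᶻ (((F ∘ suc) ⊛ G) ⊛ H) n)
    ≡⟨ cong₂ (λ a b → (F 0 *ᶻ G 0 +ᶻ 0ℤ) *ᶻ h +ᶻ (a +ᶻ b))
         (scale-⊛ (F 0) (G ∘ suc) H n) (⊛-assoc (F ∘ suc) G H n) ⟩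
  (F 0 *ᶻ G 0 +ᶻ 0ℤ) *ᶻ h +ᶻ (F 0 *ᶻ ((G ∘ suc) ⊛ H) n +ᶻ ((F ∘ suc) ⊛ (G ⊛ H)) n)
    ≡⟨ lemma (F 0) (G 0) h _ _ ⟩
  F 0 *ᶻ (G 0 *ᶻ h +ᶻ ((G ∘ suc) ⊛ H) n) +ᶻ ((F ∘ suc) ⊛ (G ⊛ H)) n ∎
  where
  open ≡-Reasoning
  h = H (suc n)
  lemma : ∀ a b c d e → (a *ᶻ b +ᶻ 0ℤ) *ᶻ c +ᶻ (a *ᶻ d +ᶻ e) ≡ a *ᶻ (b *ᶻ c +ᶻ d) +ᶻ e
  lemma = ℤ.solve-∀

⊛-zeroˡ : ∀ G → 0̂ ⊛ G ≗ 0̂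
⊛-zeroˡ G zero    = refl
⊛-zeroˡ G (suc n) = trans (ℤ.+-identityˡ _) (⊛-zeroˡ G n)

const-⊛ : ∀ c G n → (const c ⊛ G) n ≡ c *ᶻ G n
const-⊛ c G zero    = ℤ.+-identityʳ _
const-⊛ c G (suc n) = trans (cong (c *ᶻ G (suc n) +ᶻ_) (⊛-zeroˡ G n)) (ℤ.+-identityʳ _)

1̂≗const : q^ 0 ≗ const 1ℤ
1̂≗const zero    = refl
1̂≗const (suc n) = refl

0̂≗const : 0̂ ≗ const 0ℤ
0̂≗const zero    = refl
0̂≗const (suc n) = refl

⊛-identityˡ : ∀ G → q^ 0 ⊛ G ≗ G
⊛-identityˡ G n = trans (⊛-cong {G = G} 1̂≗const (λ _ → refl) n) (trans (const-⊛ 1ℤ G n) (ℤ.*-identityˡ _))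

q^-+ : ∀ a b → q^ (a + b) ≗ q^ a ⊛ q^ b
q^-+ zero    b n       = sym (⊛-identityˡ (q^ b) n)
q^-+ (suc a) b zero    = refl
q^-+ (suc a) b (suc n) = trans (q^-+ a b n) (sym (ℤ.+-identityˡ _))

4∣⊛ : ∀ F {G} n → (∀ i → i ≤ n → + 4 ∣ₛ G i) → + 4 ∣ₛ (F ⊛ G) n
4∣⊛ F zero    4∣G = ∣.∣m∣n⇒∣m+n (∣.∣n⇒∣m*n (F 0) (4∣G 0 z≤n)) (∣.divides 0ℤ refl)
4∣⊛ F (suc n) 4∣G = ∣.∣m∣n⇒∣m+n (∣.∣n⇒∣m*n (F 0) (4∣G (suc n) ℕ.≤-refl))
                      (4∣⊛ (F ∘ suc) n (λ i i≤n → 4∣G i (ℕ.m≤n⇒m≤1+n i≤n)))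

module Mod4 (N : ℕ) where

  infix 4 _~_

  -- Truncation at q^N lets finite products stand for infinite ones. As a record type, the relation
  -- lets `F` and `G` be inferred from it.
  record _~_ (F G : Series) : Set where
    constructor mk
    field at : ∀ n → n ≤ N → + 4 ∣ₛ F n -ᶻ G n
  open _~_ public

  exact : ∀ {F G} → (∀ n → n ≤ N → F n ≡ G n) → F ~ G
  exact F≗G .at n n≤N = ∣.divides 0ℤ (ℤ.i≡j⇒i-j≡0 (F≗G n n≤N))

  ~-sym : ∀ {F G} → F ~ G → G ~ F
  ~-sym {F} {G} F~G .at n n≤N =
    subst (+ 4 ∣ₛ_) (lemma (F n) (G n)) (∣.∣m⇒∣-m (at F~G n n≤N))
    where
    lemma : ∀ a b → -ᶻ (a -ᶻ b) ≡ b -ᶻ a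
    lemma = ℤ.solve-∀

  ~-trans : ∀ {F G H} → F ~ G → G ~ H → F ~ H
  ~-trans {F} {G} {H} F~G G~H .at n n≤N =
    subst (+ 4 ∣ₛ_) (lemma (F n) (G n) (H n)) (∣.∣m∣n⇒∣m+n (at F~G n n≤N) (at G~H n n≤N))
    where
    lemma : ∀ a b c → (a -ᶻ b) +ᶻ (b -ᶻ c) ≡ a -ᶻ c
    lemma = ℤ.solve-∀

  ⊕-cong : ∀ {F F′ G G′} → F ~ F′ → G ~ G′ → F ⊕ G ~ F′ ⊕ G′
  ⊕-cong {F} {F′} {G} {G′} F~F′ G~G′ .at n n≤N =
    subst (+ 4 ∣ₛ_) (lemma (F n) (F′ n) (G n) (G′ n)) (∣.∣m∣n⇒∣m+n (at F~F′ n n≤N) (at G~G′ n n≤N))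
    where
    lemma : ∀ a b c d → (a -ᶻ b) +ᶻ (c -ᶻ d) ≡ (a +ᶻ c) -ᶻ (b +ᶻ d)
    lemma = ℤ.solve-∀

  ⊖-cong : ∀ {F G} → F ~ G → ⊖ F ~ ⊖ G
  ⊖-cong {F} {G} F~G .at n n≤N =
    subst (+ 4 ∣ₛ_) (lemma (F n) (G n)) (∣.∣m⇒∣-m (at F~G n n≤N))
    where
    lemma : ∀ a b → -ᶻ (a -ᶻ b) ≡ -ᶻ a -ᶻ -ᶻ b
    lemma = ℤ.solve-∀

  ⊛-congˡ : ∀ F {G G′} → G ~ G′ → F ⊛ G ~ F ⊛ G′
  ⊛-congˡ F {G} {G′} G~G′ .at n n≤N =
    subst (+ 4 ∣ₛ_) (ℤ-cancel expand) (4∣⊛ F {G ⊝ G′} n (λ i i≤n → at G~G′ i (ℕ.≤-trans i≤n n≤N)))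
    where
    ℤ-cancel : ∀ {a b c} → a ≡ b +ᶻ c → b ≡ a -ᶻ c
    ℤ-cancel {b = b} {c} refl = lemma b c
      where
      lemma : ∀ b c → b ≡ (b +ᶻ c) -ᶻ c
      lemma = ℤ.solve-∀
    lemma : ∀ b c → b ≡ (b -ᶻ c) +ᶻ c
    lemma = ℤ.solve-∀
    expand : (F ⊛ G) n ≡ (F ⊛ (G ⊝ G′)) n +ᶻ (F ⊛ G′) n
    expand = begin
      (F ⊛ G) n
        ≡⟨ ⊛-cong {F = F} (λ _ → refl) (λ i → lemma (G i) (G′ i)) n ⟩
      (F ⊛ ((G ⊝ G′) ⊕ G′)) n
        ≡⟨ ⊛-comm F ((G ⊝ G′) ⊕ G′) n ⟩
      (((G ⊝ G′) ⊕ G′) ⊛ F) n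
        ≡⟨ ⊛-distribʳ F (G ⊝ G′) G′ n ⟩
      ((G ⊝ G′) ⊛ F) n +ᶻ (G′ ⊛ F) n
        ≡⟨ cong₂ _+ᶻ_ (⊛-comm (G ⊝ G′) F n) (⊛-comm G′ F n) ⟩
      (F ⊛ (G ⊝ G′)) n +ᶻ (F ⊛ G′) n ∎
      where open ≡-Reasoning

  ~-refl : ∀ {F} → F ~ F
  ~-refl = exact (λ _ _ → refl)

  pointwise : ∀ {F G} → F ≗ G → F ~ G
  pointwise F≗G = exact (λ n _ → F≗G n)

  ⊛-cong~ : ∀ {F F′ G G′} → F ~ F′ → G ~ G′ → F ⊛ G ~ F′ ⊛ G′
  ⊛-cong~ {F} {F′} {G} {G′} F~F′ G~G′ =
    ~-trans (⊛-congˡ F G~G′)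
    (~-trans (pointwise (⊛-comm F G′))
    (~-trans (⊛-congˡ G′ F~F′)
             (pointwise (⊛-comm G′ F′))))

  ⊕-congˡ : ∀ F {G G′} → G ~ G′ → F ⊕ G ~ F ⊕ G′
  ⊕-congˡ F = ⊕-cong (~-refl {F})

  ⊕-congʳ : ∀ G {F F′} → F ~ F′ → F ⊕ G ~ F′ ⊕ G
  ⊕-congʳ G F~F′ = ⊕-cong F~F′ (~-refl {G})

  ⊛-congʳ : ∀ G {F F′} → F ~ F′ → F ⊛ G ~ F′ ⊛ G
  ⊛-congʳ G F~F′ = ⊛-cong~ F~F′ (~-refl {G})

  seriesRing : CommutativeRing 0ℓ 0ℓ
  seriesRing = record
    { Carrier = Series ; _≈_ = _~_ ; _+_ = _⊕_ ; _*_ = _⊛_ ; -_ = ⊖_ ; 0# = 0̂ ; 1# = q^ 0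
    ; isCommutativeRing = record
      { isRing = record
        { +-isAbelianGroup = record
          { isGroup = record
            { isMonoid = record
              { isSemigroup = record
                { isMagma = record
                  { isEquivalence = record { refl = ~-refl ; sym = ~-sym ; trans = ~-trans }
                  ; ∙-cong = ⊕-cong }
                ; assoc = λ F G H → pointwise (λ n → ℤ.+-assoc (F n) (G n) (H n)) }
              ; identity = (λ F → pointwise (λ n → ℤ.+-identityˡ (F n)))
                         , (λ F → pointwise (λ n → ℤ.+-identityʳ (F n))) }
            ; inverse = (λ F → pointwise (λ n → ℤ.+-inverseˡ (F n)))
                      , (λ F → pointwise (λ n → ℤ.+-inverseʳ (F n)))
            ; ⁻¹-cong = ⊖-cong }
          ; comm = λ F G → pointwise (λ n → ℤ.+-comm (F n) (G n)) }
        ; *-cong = ⊛-cong~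
        ; *-assoc = λ F G H → pointwise (⊛-assoc F G H)
        ; *-identity = (λ F → pointwise (⊛-identityˡ F))
                     , (λ F → pointwise (λ n → trans (⊛-comm F (q^ 0) n) (⊛-identityˡ F n)))
        ; distrib = (λ F G H → ~-trans (pointwise (⊛-comm F (G ⊕ H)))
                        (~-trans (pointwise (⊛-distribʳ F G H))
                           (⊕-cong (pointwise (⊛-comm G F)) (pointwise (⊛-comm H F)))))
                  , (λ F G H → pointwise (⊛-distribʳ F G H)) }
      ; *-comm = λ F G → pointwise (⊛-comm F G) } }

  const-homo : +-*-rawRing -Raw-AlmostCommutative⟶ fromCommutativeRing seriesRing
  const-homo = record
    { ⟦_⟧    = const
    ; +-homo = λ a b → pointwise λ { zero → refl ; (suc _) → refl }
    ; *-homo = λ a b → pointwise λ { zero → sym (const-⊛ a (const b) 0)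
                                   ; (suc n) → sym (trans (const-⊛ a (const b) (suc n)) (ℤ.*-zeroʳ a)) }
    ; -‿homo = λ a → pointwise λ { zero → refl ; (suc _) → refl }
    ; 0-homo = pointwise (sym ∘ 0̂≗const)
    ; 1-homo = pointwise (sym ∘ 1̂≗const)
    }

  _coeff≟_ : WeaklyDecidable (λ a b → const a ~ const b)
  a coeff≟ b with a ℤ.≟ b
  ... | yes refl = just ~-refl
  ... | no  _    = nothing

  module Solver = Algebra.Solver.Ring _ _ const-homo _coeff≟_

  -- The solver compares coefficients in ℤ, so its identities are exact; every reduction modulo 4
  -- below goes through this lemma.
  4·-vanish : ∀ F G → F ⊕ const (+ 4) ⊛ G ~ F
  4·-vanish F G .at n n≤N = ∣.divides (G n) (trans
    (cong (λ z → F n +ᶻ z -ᶻ F n) (const-⊛ (+ 4) G n))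
    (lemma (F n) (G n)))
    where
    lemma : ∀ a b → a +ᶻ + 4 *ᶻ b -ᶻ a ≡ b *ᶻ + 4
    lemma = ℤ.solve-∀

-- Supports

sum< : ℕ → (ℕ → Series) → Series
sum< zero    F = 0̂
sum< (suc n) F = sum< n F ⊕ F n

-- A disjunction instead of an implication from `F n ≢ 0ℤ`: a product then yields a decomposition of
-- its index constructively.
Supp : (ℕ → Set) → Series → Set
Supp A F = ∀ n → F n ≡ 0ℤ ⊎ A n

q^-supp : ∀ a → Supp (a ≡_) (q^ a)
q^-supp zero    zero    = inj₂ refl
q^-supp zero    (suc n) = inj₁ refl
q^-supp (suc a) zero    = inj₁ refl
q^-supp (suc a) (suc n) with q^-supp a n
... | inj₁ eq = inj₁ eq
... | inj₂ eq = inj₂ (cong suc eq)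

⊕-supp : ∀ {A F G} → Supp A F → Supp A G → Supp A (F ⊕ G)
⊕-supp F G n with F n | G n
... | inj₂ a | _      = inj₂ a
... | inj₁ _ | inj₂ a = inj₂ a
... | inj₁ x | inj₁ y = inj₁ (cong₂ _+ᶻ_ x y)

⊖-supp : ∀ {A F} → Supp A F → Supp A (⊖ F)
⊖-supp F n with F n
... | inj₂ a = inj₂ a
... | inj₁ x = inj₁ (cong -ᶻ_ x)

const-⊛-supp : ∀ {A F} c → Supp A F → Supp A (const c ⊛ F)
const-⊛-supp {F = F} c sF n with sF n
... | inj₂ a = inj₂ a
... | inj₁ x = inj₁ (trans (const-⊛ c F n) (trans (cong (c *ᶻ_) x) (ℤ.*-zeroʳ c)))

sum-supp : ∀ {A} {F : ℕ → Series} n → (∀ i → Supp A (F i)) → Supp A (sum< n F)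
sum-supp zero    sF = λ _ → inj₁ refl
sum-supp (suc n) sF = ⊕-supp (sum-supp n sF) (sF n)

weaken-supp : ∀ {A B F} → (∀ {n} → A n → B n) → Supp A F → Supp B F
weaken-supp A⊆B sF n with sF n
... | inj₁ x = inj₁ x
... | inj₂ a = inj₂ (A⊆B a)

⊛-supp : ∀ {A B F G} → Supp A F → Supp B G →
         Supp (λ n → ∃[ i ] ∃[ j ] i + j ≡ n × A i × B j) (F ⊛ G)
⊛-supp {F = F} {G} sF sG zero with sF 0 | sG 0
... | inj₁ x | _      rewrite x = inj₁ refl
... | inj₂ a | inj₁ y rewrite y | ℤ.*-zeroʳ (F 0) = inj₁ refl
... | inj₂ a | inj₂ b = inj₂ (0 , 0 , refl , a , b)
⊛-supp {F = F} {G} sF sG (suc n) with ⊛-supp (sF ∘ suc) sG n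
... | inj₂ (i , j , eq , a , b) = inj₂ (suc i , j , cong suc eq , a , b)
... | inj₁ z with sF 0 | sG (suc n)
...   | inj₁ x | _      rewrite x | z = inj₁ refl
...   | inj₂ a | inj₁ y rewrite y | ℤ.*-zeroʳ (F 0) | z = inj₁ refl
...   | inj₂ a | inj₂ b = inj₂ (0 , suc n , refl , a , b)

-- Squares of Euler products modulo 4

module Theta (N : ℕ) where
  open Mod4 N
  open Solver using (solve; _:+_; _:*_; _:-_; _:=_; con; _:^_; Polynomial)
  open import Relation.Binary.Reasoning.Setoid (CommutativeRing.setoid seriesRing)

  -- The zeroth power denotes q^ 0 definitionally, whereas con 1ℤ denotes const 1ℤ.
  :1 : ∀ {n} → Polynomial n
  :1 = con 1ℤ :^ 0

  q^-vanish : ∀ {a} → N < a → q^ a ~ 0̂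
  q^-vanish {a} N<a = exact λ n n≤N → helper n (ℕ.≤-<-trans n≤N N<a)
    where
    helper : ∀ n → n < a → (q^ a) n ≡ 0ℤ
    helper n n<a with q^-supp a n
    ... | inj₁ x    = x
    ... | inj₂ refl with () ← ℕ.<-irrefl refl n<a

  q^-cong : ∀ {a b} → a ≡ b → q^ a ~ q^ b
  q^-cong refl = ~-refl

  sum-cong : ∀ n {F G : ℕ → Series} → (∀ i → F i ~ G i) → sum< n F ~ sum< n G
  sum-cong zero    F~G = ~-refl
  sum-cong (suc n) F~G = ⊕-cong (sum-cong n F~G) (F~G n)

  sum-⊕ : ∀ n (F G : ℕ → Series) → sum< n (λ i → F i ⊕ G i) ~ sum< n F ⊕ sum< n G
  sum-⊕ zero    F G = ~-refl
  sum-⊕ (suc n) F G = begin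
    sum< n (λ i → F i ⊕ G i) ⊕ (F n ⊕ G n)  ≈⟨ ⊕-congʳ (F n ⊕ G n) (sum-⊕ n F G) ⟩
    sum< n F ⊕ sum< n G ⊕ (F n ⊕ G n)
      ≈⟨ solve 4 (λ a b c d → a :+ b :+ (c :+ d) := a :+ c :+ (b :+ d)) ~-refl
           (sum< n F) (sum< n G) (F n) (G n) ⟩
    sum< n F ⊕ F n ⊕ (sum< n G ⊕ G n)       ∎

  -- The off-diagonal terms pair up, and each pair contributes 4 a i j.
  double-symmetric : ∀ n (a : ℕ → ℕ → Series) → (∀ i j → a i j ~ a j i) →
    const (+ 2) ⊛ sum< n (λ i → sum< n (a i)) ~ const (+ 2) ⊛ sum< n (λ i → a i i)
  double-symmetric zero    a sym-a = ~-refl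
  double-symmetric (suc n) a sym-a = begin
    const (+ 2) ⊛ (sum< n (λ i → sum< n (a i) ⊕ a i n) ⊕ (row ⊕ a n n))
      ≈⟨ ⊛-congˡ (const (+ 2)) (⊕-congʳ (row ⊕ a n n) (sum-⊕ n (λ i → sum< n (a i)) (λ i → a i n))) ⟩
    const (+ 2) ⊛ (square ⊕ sum< n (λ i → a i n) ⊕ (row ⊕ a n n))
      ≈⟨ ⊛-congˡ (const (+ 2)) (⊕-congʳ (row ⊕ a n n) (⊕-congˡ square (sum-cong n (λ i → sym-a i n)))) ⟩
    const (+ 2) ⊛ (square ⊕ row ⊕ (row ⊕ a n n))
      ≈⟨ solve 3 (λ s r d → con (+ 2) :* (s :+ r :+ (r :+ d))
             := (con (+ 2) :* s :+ con (+ 2) :* d) :+ con (+ 4) :* r) ~-refl square row (a n n) ⟩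
    const (+ 2) ⊛ square ⊕ const (+ 2) ⊛ a n n ⊕ const (+ 4) ⊛ row
      ≈⟨ 4·-vanish _ row ⟩
    const (+ 2) ⊛ square ⊕ const (+ 2) ⊛ a n n
      ≈⟨ ⊕-congʳ (const (+ 2) ⊛ a n n) (double-symmetric n a sym-a) ⟩
    const (+ 2) ⊛ sum< n (λ i → a i i) ⊕ const (+ 2) ⊛ a n n
      ≈⟨ solve 2 (λ s d → con (+ 2) :* s :+ con (+ 2) :* d := con (+ 2) :* (s :+ d)) ~-refl
           (sum< n (λ i → a i i)) (a n n) ⟩
    const (+ 2) ⊛ sum< (suc n) (λ i → a i i) ∎
    where
    row square : Series
    row    = sum< n (a n)
    square = sum< n (λ i → sum< n (a i))

  -- Telescoping of (1 - y)(y + ... + y^n) = y - y^(n+1) with y = q^a. The remainder stays on the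
  -- left as a summand; in `lambert-eq` its exponent exceeds N and it drops out.
  geometric : ∀ a n → (q^ 0 ⊝ q^ a) ⊛ sum< n (λ j → q^ (a * suc j)) ⊕ q^ (a * suc n) ~ q^ a
  geometric a zero = begin
    (q^ 0 ⊝ q^ a) ⊛ 0̂ ⊕ q^ (a * 1) ≈⟨ ⊕-cong (pointwise (⊛-comm (q^ 0 ⊝ q^ a) 0̂)) (q^-cong (ℕ.*-identityʳ a)) ⟩
    0̂ ⊛ (q^ 0 ⊝ q^ a) ⊕ q^ a       ≈⟨ ⊕-congʳ (q^ a) (pointwise (⊛-zeroˡ (q^ 0 ⊝ q^ a))) ⟩
    0̂ ⊕ q^ a                       ≈⟨ pointwise (λ n → ℤ.+-identityˡ ((q^ a) n)) ⟩
    q^ a                           ∎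
  geometric a (suc n) = begin
    u ⊛ (s ⊕ z) ⊕ q^ (a * suc (suc n))
      ≈⟨ ⊕-congˡ (u ⊛ (s ⊕ z)) (~-trans (q^-cong (ℕ.*-suc a (suc n))) (pointwise (q^-+ a (a * suc n)))) ⟩
    u ⊛ (s ⊕ z) ⊕ q^ a ⊛ z
      ≈⟨ solve 3 (λ y s z → (:1 :- y) :* (s :+ z) :+ y :* z := (:1 :- y) :* s :+ z) ~-refl (q^ a) s z ⟩
    u ⊛ s ⊕ z
      ≈⟨ geometric a n ⟩
    q^ a ∎
    where
    u s z : Series
    u = q^ 0 ⊝ q^ a
    s = sum< n (λ j → q^ (a * suc j))
    z = q^ (a * suc n)

  f~∏ : ∀ k .{{_ : NonZero k}} → f k ~ ∏[1-q^ k ·i] N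
  f~∏ k = exact λ n n≤N → trans (sym (f-stable k n (N ∸ n)))
            (cong (λ M → (∏[1-q^ k ·i] M) n) (ℕ.m∸n+n≡m n≤N))

  module _ (k : ℕ) .{{_ : NonZero k}} where

    -- q^ka / (1 - q^ka) up to q^N.
    lambert : ℕ → Series
    lambert a = sum< N (λ j → q^ (k * a * suc j))

    lambert-eq : ∀ a → (q^ 0 ⊝ q^ (k * suc a)) ⊛ lambert (suc a) ~ q^ (k * suc a)
    lambert-eq a = begin
      s                                  ≈⟨ pointwise (λ n → sym (ℤ.+-identityʳ (s n))) ⟩
      s ⊕ 0̂                              ≈⟨ ⊕-congˡ s (q^-vanish (ℕ.m≤n*m (suc N) (k * suc a) {{ℕ.m*n≢0 k (suc a)}})) ⟨
      s ⊕ q^ (k * suc a * suc N)         ≈⟨ geometric (k * suc a) N ⟩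
      q^ (k * suc a)                     ∎
      where
      s : Series
      s = (q^ 0 ⊝ q^ (k * suc a)) ⊛ lambert (suc a)

    -- (1 - y)² / (1 - y²) = 1 - 2y / (1 + y) ≡ 1 + 2y / (1 - y) (mod 4), and a
    -- product of factors 1 + 2gᵢ is 1 + 2 Σ gᵢ modulo 4.
    square-product : ∀ n →
      (∏[1-q^ k ·i] n) ⊛ (∏[1-q^ k ·i] n)
        ~ (∏[1-q^ 2 * k ·i] n) ⊛ (q^ 0 ⊕ const (+ 2) ⊛ sum< n (lambert ∘ suc))
    square-product zero    = begin
      q^ 0 ⊛ q^ 0
        ≈⟨ solve 0 (:1 :* :1 := :1 :* (:1 :+ con (+ 2) :* con 0ℤ)) ~-refl ⟩
      q^ 0 ⊛ (q^ 0 ⊕ const (+ 2) ⊛ const 0ℤ)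
        ≈⟨ ⊛-congˡ (q^ 0) (⊕-congˡ (q^ 0) (⊛-congˡ (const (+ 2)) (pointwise 0̂≗const))) ⟨
      q^ 0 ⊛ (q^ 0 ⊕ const (+ 2) ⊛ 0̂) ∎
    square-product (suc n) = begin
      (p ⊛ u) ⊛ (p ⊛ u)
        ≈⟨ solve 2 (λ p y → (p :* (:1 :- y)) :* (p :* (:1 :- y)) := (p :* p) :* ((:1 :- y) :* (:1 :- y)))
             ~-refl p y ⟩
      (p ⊛ p) ⊛ (u ⊛ u)
        ≈⟨ ⊛-congʳ (u ⊛ u) (square-product n) ⟩
      (p′ ⊛ (q^ 0 ⊕ const (+ 2) ⊛ d)) ⊛ (u ⊛ u)
        -- The multiple of 4 is chosen so that 4y turns (1 - y)² into (1 - y²) + 2y(1 + y), and 4d(y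
        -- - y²) turns 2d(1 - y)² into 2d(1 - y²).
        ≈⟨ 4·-vanish ((p′ ⊛ (q^ 0 ⊕ const (+ 2) ⊛ d)) ⊛ (u ⊛ u)) (p′ ⊛ (y ⊕ d ⊛ (y ⊝ y ⊛ y))) ⟨
      (p′ ⊛ (q^ 0 ⊕ const (+ 2) ⊛ d)) ⊛ (u ⊛ u) ⊕ const (+ 4) ⊛ (p′ ⊛ (y ⊕ d ⊛ (y ⊝ y ⊛ y)))
        ≈⟨ solve 3 (λ p y d →
             (p :* (:1 :+ con (+ 2) :* d)) :* ((:1 :- y) :* (:1 :- y)) :+ con (+ 4) :* (p :* (y :+ d :* (y :- y :* y)))
               := p :* (:1 :- y :* y) :* (:1 :+ con (+ 2) :* d) :+ (con (+ 2) :* p :* (:1 :+ y)) :* y)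
             ~-refl p′ y d ⟩
      p′ ⊛ (q^ 0 ⊝ y ⊛ y) ⊛ (q^ 0 ⊕ const (+ 2) ⊛ d) ⊕ (const (+ 2) ⊛ p′ ⊛ (q^ 0 ⊕ y)) ⊛ y
        -- Writing the last factor y as (1 - y)g makes 1 - y² a common factor without any division.
        ≈⟨ ⊕-congˡ (p′ ⊛ (q^ 0 ⊝ y ⊛ y) ⊛ (q^ 0 ⊕ const (+ 2) ⊛ d))
             (⊛-congˡ (const (+ 2) ⊛ p′ ⊛ (q^ 0 ⊕ y)) (lambert-eq n)) ⟨
      p′ ⊛ (q^ 0 ⊝ y ⊛ y) ⊛ (q^ 0 ⊕ const (+ 2) ⊛ d) ⊕ (const (+ 2) ⊛ p′ ⊛ (q^ 0 ⊕ y)) ⊛ (u ⊛ g)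
        ≈⟨ solve 4 (λ p y d g →
             p :* (:1 :- y :* y) :* (:1 :+ con (+ 2) :* d) :+ (con (+ 2) :* p :* (:1 :+ y)) :* ((:1 :- y) :* g)
               := p :* (:1 :- y :* y) :* (:1 :+ con (+ 2) :* (d :+ g)))
             ~-refl p′ y d g ⟩
      p′ ⊛ (q^ 0 ⊝ y ⊛ y) ⊛ (q^ 0 ⊕ const (+ 2) ⊛ (d ⊕ g))
        ≈⟨ ⊛-congʳ (q^ 0 ⊕ const (+ 2) ⊛ (d ⊕ g)) (⊛-congˡ p′ (⊕-congˡ (q^ 0) (⊖-cong y²))) ⟩
      p′ ⊛ (q^ 0 ⊝ q^ (2 * k * suc n)) ⊛ (q^ 0 ⊕ const (+ 2) ⊛ (d ⊕ g)) ∎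
      where
      y u p p′ d g : Series
      y = q^ (k * suc n)
      u = q^ 0 ⊝ y
      p = ∏[1-q^ k ·i] n
      p′ = ∏[1-q^ 2 * k ·i] n
      d = sum< n (lambert ∘ suc)
      g = lambert (suc n)
      doubling : ∀ k n → k * n + k * n ≡ 2 * k * n
      doubling = ℕ.solve-∀
      y² : y ⊛ y ~ q^ (2 * k * suc n)
      y² = ~-trans (pointwise (λ i → sym (q^-+ (k * suc n) (k * suc n) i)))
                   (q^-cong (doubling k (suc n)))

    squares : Series
    squares = sum< N (λ i → q^ (k * suc i * suc i))

    f²-mod-4 : f k ⊛ f k ~ f (2 * k) ⊛ (q^ 0 ⊕ const (+ 2) ⊛ squares)
    f²-mod-4 = begin
      f k ⊛ f k ≈⟨ ⊛-cong~ (f~∏ k) (f~∏ k) ⟩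
      (∏[1-q^ k ·i] N) ⊛ (∏[1-q^ k ·i] N)
        ≈⟨ square-product N ⟩
      (∏[1-q^ 2 * k ·i] N) ⊛ (q^ 0 ⊕ const (+ 2) ⊛ sum< N (lambert ∘ suc))
        -- The Lambert sums add up to the double sum of q^(kij) over 1 ≤ i, j ≤ N, which is
        -- symmetric in i and j; modulo 4 its double is twice the diagonal, that is, twice
        -- `squares`.
        ≈⟨ ⊛-cong~ (~-sym (f~∏ (2 * k) {{ℕ.m*n≢0 2 k}})) (⊕-congˡ (q^ 0)
             (double-symmetric N (λ i j → q^ (k * suc i * suc j)) (λ i j → q^-cong (swap k (suc i) (suc j))))) ⟩
      f (2 * k) ⊛ (q^ 0 ⊕ const (+ 2) ⊛ squares) ∎
      where
      swap : ∀ a b c → a * b * c ≡ a * c * b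
      swap = ℕ.solve-∀

-- The pentagonal number theorem

σ : ℕ → ℤ
σ zero    = 1ℤ
σ (suc n) = -ᶻ σ n

triangular : ℕ → ℕ
triangular zero    = 0
triangular (suc n) = suc n + triangular n

-- The factor 24 is the one in 24 e + 1, where the formula is applied; it keeps halves away.
triangular-formula : ∀ n → 24 * triangular n ≡ 12 * (n * suc n)
triangular-formula zero    = refl
triangular-formula (suc n) = begin
  24 * (suc n + triangular n)        ≡⟨ ℕ.*-distribˡ-+ 24 (suc n) (triangular n) ⟩
  24 * suc n + 24 * triangular n     ≡⟨ cong (_+_ (24 * suc n)) (triangular-formula n) ⟩
  24 * suc n + 12 * (n * suc n)      ≡⟨ lemma n ⟩
  12 * (suc n * suc (suc n))         ∎
  where
  open ≡-Reasoning
  lemma : ∀ n → 24 * suc n + 12 * (n * suc n) ≡ 12 * (suc n * suc (suc n))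
  lemma = ℕ.solve-∀

module Pentagonal (N k : ℕ) .{{_ : NonZero k}} where
  open Mod4 N
  open Solver using (solve; _:+_; _:*_; _:-_; :-_; _:=_; con)
  open Theta N
  open import Relation.Binary.Reasoning.Setoid (CommutativeRing.setoid seriesRing)

  -- The quotient of (q^k;q^k)_(s+l) by (q^k;q^k)_s, formed without division.
  ∏[1-q^k·_+i]_ : ℕ → ℕ → Series
  ∏[1-q^k· s +i] zero  = q^ 0
  ∏[1-q^k· s +i] suc l = (∏[1-q^k· s +i] l) ⊛ (q^ 0 ⊝ q^ (k * suc (s + l)))

  -- The definition splits off the factor of largest index; passing from s to s + 1 in
  -- `partial-step` needs the one of smallest index.
  ∏-head : ∀ s l → ∏[1-q^k· s +i] suc l ~ (q^ 0 ⊝ q^ (k * suc s)) ⊛ ∏[1-q^k· suc s +i] l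
  ∏-head s zero    = begin
    q^ 0 ⊛ (q^ 0 ⊝ q^ (k * suc (s + 0)))
      ≈⟨ solve 1 (λ y → :1 :* (:1 :- y) := (:1 :- y) :* :1) ~-refl (q^ (k * suc (s + 0))) ⟩
    (q^ 0 ⊝ q^ (k * suc (s + 0))) ⊛ q^ 0
      ≈⟨ ⊛-congʳ (q^ 0) (⊕-congˡ (q^ 0) (⊖-cong (q^-cong (cong (λ z → k * suc z) (ℕ.+-identityʳ s))))) ⟩
    (q^ 0 ⊝ q^ (k * suc s)) ⊛ q^ 0 ∎
  ∏-head s (suc l) = begin
    (∏[1-q^k· s +i] suc l) ⊛ (q^ 0 ⊝ q^ (k * suc (s + suc l)))
      ≈⟨ ⊛-cong~ (∏-head s l) (⊕-congˡ (q^ 0) (⊖-cong (q^-cong (cong (λ z → k * suc z) (ℕ.+-suc s l))))) ⟩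
    (q^ 0 ⊝ q^ (k * suc s)) ⊛ (∏[1-q^k· suc s +i] l) ⊛ (q^ 0 ⊝ q^ (k * suc (suc s + l)))
      ≈⟨ pointwise (⊛-assoc (q^ 0 ⊝ q^ (k * suc s)) (∏[1-q^k· suc s +i] l) (q^ 0 ⊝ q^ (k * suc (suc s + l)))) ⟩
    (q^ 0 ⊝ q^ (k * suc s)) ⊛ ∏[1-q^k· suc s +i] suc l ∎

  ∏-zero : ∀ l → ∏[1-q^k· 0 +i] l ~ ∏[1-q^ k ·i] l
  ∏-zero zero    = ~-refl
  ∏-zero (suc l) = ⊛-congʳ (q^ 0 ⊝ q^ (k * suc l)) (∏-zero l)

  -- Shanks' proof: the sum of (-1)^s (P n / P s) q^k(sn + s(s+1)/2) over s ≤ n, with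
  -- P n = ∏[1-q^ k ·i] n, is a partial sum of the pentagonal series, and only its
  -- term P n at s = 0 matters up to q^n.
  term : ℕ → ℕ → Series
  term n s = const (σ s) ⊛ ∏[1-q^k· s +i] (n ∸ s) ⊛ q^ (k * (s * n + triangular s))

  partial : ℕ → ℕ → Series
  partial n zero    = term n 0
  partial n (suc m) = partial n m ⊕ term n (suc m)

  term-split : ∀ s l → term (s + l) s ≡
    const (σ s) ⊛ ∏[1-q^k· s +i] l ⊛ q^ (k * (s * (s + l) + triangular s))
  term-split s l = cong (λ z → const (σ s) ⊛ ∏[1-q^k· s +i] z ⊛ q^ (k * (s * (s + l) + triangular s)))
                        (ℕ.m+n∸m≡n s l)

  const-neg : ∀ c → const (-ᶻ c) ~ ⊖ const c
  const-neg c = pointwise λ { zero → refl ; (suc _) → refl }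

  -- Induction on m, in which the second summand on the left is the boundary term of a telescoping.
  -- For m = n its product is empty, and it supplies the first of the two new powers of q in
  -- `pentagonal (suc n)`.
  partial-step : ∀ m l n → n ≡ m + l →
    partial (suc n) m ⊕ const (σ m) ⊛ (∏[1-q^k· m +i] l) ⊛ q^ (k * (suc m * suc n + triangular m))
      ~ partial n m
  partial-step zero    l n refl = begin
    const (+ 1) ⊛ (π ⊛ (q^ 0 ⊝ w)) ⊛ q^ (k * 0) ⊕ const (+ 1) ⊛ π ⊛ q^ (k * (1 * suc l + 0))
      ≈⟨ ⊕-congˡ (const (+ 1) ⊛ (π ⊛ (q^ 0 ⊝ w)) ⊛ q^ (k * 0))
           (⊛-congˡ (const (+ 1) ⊛ π) (~-trans (q^-cong (index k (suc l))) (pointwise (q^-+ (k * suc l) (k * 0))))) ⟩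
    const (+ 1) ⊛ (π ⊛ (q^ 0 ⊝ w)) ⊛ q^ (k * 0) ⊕ const (+ 1) ⊛ π ⊛ (w ⊛ q^ (k * 0))
      ≈⟨ solve 3 (λ p w z → con (+ 1) :* (p :* (:1 :- w)) :* z :+ con (+ 1) :* p :* (w :* z) := con (+ 1) :* p :* z)
           ~-refl π w (q^ (k * 0)) ⟩
    const (+ 1) ⊛ π ⊛ q^ (k * 0) ∎
    where
    π w : Series
    π = ∏[1-q^k· 0 +i] l
    w = q^ (k * suc l)
    index : ∀ k l → k * (1 * l + 0) ≡ k * l + k * 0
    index = ℕ.solve-∀
  partial-step (suc m) l n refl = begin
    partial (suc n) m ⊕ term (suc n) (suc m)
      ⊕ const (σ (suc m)) ⊛ π ⊛ q^ (k * (suc (suc m) * suc n + triangular (suc m)))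
      ≈⟨ ⊕-cong (⊕-congˡ (partial (suc n) m) upper) rest ⟩
    partial (suc n) m ⊕ (⊖ s) ⊛ (π ⊛ (q^ 0 ⊝ w)) ⊛ (z ⊛ y) ⊕ (⊖ s) ⊛ π ⊛ (w ⊛ (z ⊛ y))
      -- The terms in w cancel. What remains is -szπy = s(1 - z)πy - sπy: the boundary term for m,
      -- once `∏-head` absorbs 1 - z, and the new term of `partial n (suc m)`.
      ≈⟨ solve 6 (λ g s p w z y →
           g :+ (:- s) :* (p :* (:1 :- w)) :* (z :* y) :+ (:- s) :* p :* (w :* (z :* y))
             := (g :+ s :* ((:1 :- z) :* p) :* y) :+ (:- s) :* p :* y)
           ~-refl (partial (suc n) m) s π w z y ⟩
    partial (suc n) m ⊕ s ⊛ ((q^ 0 ⊝ z) ⊛ π) ⊛ y ⊕ (⊖ s) ⊛ π ⊛ y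
      ≈⟨ ⊕-congʳ ((⊖ s) ⊛ π ⊛ y) (⊕-congˡ (partial (suc n) m) (⊛-congʳ y (⊛-congˡ s (∏-head m l)))) ⟨
    partial (suc n) m ⊕ s ⊛ (∏[1-q^k· m +i] suc l) ⊛ y ⊕ (⊖ s) ⊛ π ⊛ y
      ≈⟨ ⊕-cong (partial-step m (suc l) n (sym (ℕ.+-suc m l))) (~-sym lower) ⟩
    partial n m ⊕ term n (suc m) ∎
    where
    s π w z y : Series
    s = const (σ m)
    π = ∏[1-q^k· suc m +i] l
    w = q^ (k * suc n)
    z = q^ (k * suc m)
    y = q^ (k * (suc m * suc n + triangular m))

    zy-index : ∀ k m n t → k * (suc m * n + (suc m + t)) ≡ k * suc m + k * (suc m * n + t)
    zy-index = ℕ.solve-∀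
    zy : q^ (k * (suc m * suc n + triangular (suc m))) ~ z ⊛ y
    zy = ~-trans (q^-cong (zy-index k m (suc n) (triangular m)))
                 (pointwise (q^-+ (k * suc m) (k * (suc m * suc n + triangular m))))

    upper : term (suc n) (suc m) ~ (⊖ s) ⊛ (π ⊛ (q^ 0 ⊝ w)) ⊛ (z ⊛ y)
    upper = begin
      term (suc n) (suc m)
        ≡⟨ cong (λ j → term j (suc m)) (ℕ.+-suc (suc m) l) ⟨
      term (suc m + suc l) (suc m)
        ≡⟨ term-split (suc m) (suc l) ⟩
      const (σ (suc m)) ⊛ (π ⊛ (q^ 0 ⊝ w)) ⊛ q^ (k * (suc m * (suc m + suc l) + triangular (suc m)))
        ≈⟨ ⊛-cong~ (⊛-congʳ (π ⊛ (q^ 0 ⊝ w)) (const-neg (σ m)))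
             (~-trans (q^-cong (cong (λ j → k * (suc m * j + triangular (suc m))) (ℕ.+-suc (suc m) l))) zy) ⟩
      (⊖ s) ⊛ (π ⊛ (q^ 0 ⊝ w)) ⊛ (z ⊛ y) ∎

    rest-index : ∀ k m n t → k * (suc (suc m) * n + t) ≡ k * n + k * (suc m * n + t)
    rest-index = ℕ.solve-∀
    rest : const (σ (suc m)) ⊛ π ⊛ q^ (k * (suc (suc m) * suc n + triangular (suc m)))
             ~ (⊖ s) ⊛ π ⊛ (w ⊛ (z ⊛ y))
    rest = ⊛-cong~ (⊛-congʳ π (const-neg (σ m)))
      (~-trans (q^-cong (rest-index k m (suc n) (triangular (suc m))))
      (~-trans (pointwise (q^-+ (k * suc n) (k * (suc m * suc n + triangular (suc m)))))
               (⊛-congˡ w zy)))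

    lower-index : ∀ m n t → suc m * n + (suc m + t) ≡ suc m * suc n + t
    lower-index = ℕ.solve-∀
    lower : term n (suc m) ~ (⊖ s) ⊛ π ⊛ y
    lower = begin
      term n (suc m)
        ≡⟨ term-split (suc m) l ⟩
      const (σ (suc m)) ⊛ π ⊛ q^ (k * (suc m * n + triangular (suc m)))
        ≈⟨ ⊛-cong~ (⊛-congʳ π (const-neg (σ m))) (q^-cong (cong (k *_) (lower-index m n (triangular m)))) ⟩
      (⊖ s) ⊛ π ⊛ y ∎

  -- With j = n + 1 the two exponents are k j(3j - 1)/2 and k j(3j + 1)/2, both with sign (-1)^j.
  pentagonal : ℕ → Series
  pentagonal zero    = const 1ℤ
  pentagonal (suc n) = pentagonal n ⊝ const (σ n) ⊛
    (q^ (k * (suc n * suc n + triangular n)) ⊕ q^ (k * (suc n * suc n + triangular (suc n))))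

  shanks : ∀ n → partial n n ~ pentagonal n
  shanks zero = begin
    const 1ℤ ⊛ q^ 0 ⊛ q^ (k * 0) ≈⟨ ⊛-congˡ (const 1ℤ ⊛ q^ 0) (q^-cong (ℕ.*-zeroʳ k)) ⟩
    const 1ℤ ⊛ q^ 0 ⊛ q^ 0       ≈⟨ solve 0 (con 1ℤ :* :1 :* :1 := con 1ℤ) ~-refl ⟩
    const 1ℤ ∎
  shanks (suc n) = begin
    partial (suc n) n ⊕ term (suc n) (suc n)
      ≈⟨ ⊕-congˡ (partial (suc n) n) last ⟩
    partial (suc n) n ⊕ (⊖ s) ⊛ q^ 0 ⊛ y
      ≈⟨ solve 4 (λ g s x y → g :+ (:- s) :* :1 :* y := (g :+ s :* :1 :* x) :- s :* (x :+ y))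
           ~-refl (partial (suc n) n) s x y ⟩
    (partial (suc n) n ⊕ s ⊛ q^ 0 ⊛ x) ⊝ s ⊛ (x ⊕ y)
      ≈⟨ ⊕-congʳ (⊖ (s ⊛ (x ⊕ y))) (~-trans (partial-step n 0 n (sym (ℕ.+-identityʳ n))) (shanks n)) ⟩
    pentagonal n ⊝ s ⊛ (x ⊕ y) ∎
    where
    s x y : Series
    s = const (σ n)
    x = q^ (k * (suc n * suc n + triangular n))
    y = q^ (k * (suc n * suc n + triangular (suc n)))
    last : term (suc n) (suc n) ~ (⊖ s) ⊛ q^ 0 ⊛ y
    last = ~-trans
      (pointwise λ i → cong (λ j → (const (σ (suc n)) ⊛ (∏[1-q^k· suc n +i] j) ⊛ y) i) (ℕ.n∸n≡0 n))
      (⊛-congʳ y (⊛-congʳ (q^ 0) (const-neg (σ n))))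

  partial-truncated : ∀ m → partial N m ~ ∏[1-q^ k ·i] N
  partial-truncated zero    = begin
    const 1ℤ ⊛ (∏[1-q^k· 0 +i] N) ⊛ q^ (k * 0)
      ≈⟨ ⊛-cong~ (⊛-congˡ (const 1ℤ) (∏-zero N)) (q^-cong (ℕ.*-zeroʳ k)) ⟩
    const 1ℤ ⊛ (∏[1-q^ k ·i] N) ⊛ q^ 0
      ≈⟨ solve 1 (λ p → con 1ℤ :* p :* :1 := p) ~-refl (∏[1-q^ k ·i] N) ⟩
    ∏[1-q^ k ·i] N ∎
  partial-truncated (suc m) = begin
    partial N m ⊕ c ⊛ q^ (k * (suc m * N + triangular (suc m)))
      ≈⟨ ⊕-cong (partial-truncated m) (⊛-congˡ c (q^-vanish N<)) ⟩
    (∏[1-q^ k ·i] N) ⊕ c ⊛ 0̂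
      ≈⟨ pointwise (λ n → trans (cong ((∏[1-q^ k ·i] N) n +ᶻ_) (trans (⊛-comm c 0̂ n) (⊛-zeroˡ c n)))
                                (ℤ.+-identityʳ _)) ⟩
    ∏[1-q^ k ·i] N ∎
    where
    c : Series
    c = const (σ (suc m)) ⊛ ∏[1-q^k· suc m +i] (N ∸ suc m)
    -- Here (m + 1)N ≥ N, and the positive triangular number makes the inequality strict.
    N< : N < k * (suc m * N + triangular (suc m))
    N< = ℕ.<-≤-trans (ℕ.m<m+n N (s≤s z≤n))
           (ℕ.≤-trans (ℕ.+-monoˡ-≤ (triangular (suc m)) (ℕ.m≤n*m N (suc m))) (ℕ.m≤n*m _ k))

  f~pentagonal : f k ~ pentagonal N
  f~pentagonal = ~-trans (f~∏ k) (~-trans (~-sym (partial-truncated N)) (shanks N))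

  -- A number e is generalized pentagonal exactly when 24 e + 1 is a square; this form feeds
  -- directly into the quadratic forms below.
  GeneralizedPentagonal : ℕ → Set
  GeneralizedPentagonal n = ∃[ e ] ∃[ x ] k * e ≡ n × 24 * e + 1 ≡ x * x

  pentagonal-supp : ∀ n → Supp GeneralizedPentagonal (pentagonal n)
  pentagonal-supp zero    zero    = inj₂ (0 , 1 , ℕ.*-zeroʳ k , refl)
  pentagonal-supp zero    (suc i) = inj₁ refl
  pentagonal-supp (suc n) = ⊕-supp (pentagonal-supp n) (⊖-supp (const-⊛-supp (σ n) (⊕-supp
    -- With j = n + 1 the square roots of 24 e + 1 are 6j - 1 and 6j + 1.
    (weaken-supp (λ eq → _ , 6 * n + 5 , eq , x-eq) (q^-supp _))
    (weaken-supp (λ eq → _ , 6 * n + 7 , eq , y-eq) (q^-supp _)))))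
    where
    x-lemma : ∀ n → 24 * (suc n * suc n) + 12 * (n * suc n) + 1 ≡ (6 * n + 5) * (6 * n + 5)
    x-lemma = ℕ.solve-∀
    y-lemma : ∀ n → 24 * (suc n * suc n) + 12 * (suc n * suc (suc n)) + 1 ≡ (6 * n + 7) * (6 * n + 7)
    y-lemma = ℕ.solve-∀
    expand : ∀ a m → 24 * (a + triangular m) + 1 ≡ 24 * a + 12 * (m * suc m) + 1
    expand a m = cong (_+ 1) (trans (ℕ.*-distribˡ-+ 24 a (triangular m))
                                    (cong (_+_ (24 * a)) (triangular-formula m)))
    x-eq : 24 * (suc n * suc n + triangular n) + 1 ≡ (6 * n + 5) * (6 * n + 5)
    x-eq = trans (expand (suc n * suc n) n) (x-lemma n)
    y-eq : 24 * (suc n * suc n + triangular (suc n)) + 1 ≡ (6 * n + 7) * (6 * n + 7)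
    y-eq = trans (expand (suc n * suc n) (suc n)) (y-lemma n)

-- EOᵤ modulo 4

module _ (w : ℕ) where
  open Mod4 w
  open Solver using (solve; _:+_; _:*_; _:=_; con)
  open Theta w
  open Pentagonal w
  open import Relation.Binary.Reasoning.Setoid (CommutativeRing.setoid seriesRing)

  -- This is f₂⁴ ≡ f₄² divided by f₂², which is invertible because its constant term computes to 1.
  EOᵤ~f₂² : EOᵤ ~ f 2 ⊛ f 2
  EOᵤ~f₂² = begin
    EOᵤ                        ≈⟨ solve 1 (λ x → x := x :* :1) ~-refl EOᵤ ⟩
    EOᵤ ⊛ q^ 0                 ≈⟨ ⊛-congˡ EOᵤ (pointwise (÷-⊛ (q^ 0) f₂² refl)) ⟨
    EOᵤ ⊛ (f₂⁻² ⊛ f₂²)         ≈⟨ solve 3 (λ x y z → x :* (y :* z) := x :* z :* y) ~-refl EOᵤ f₂⁻² f₂² ⟩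
    EOᵤ ⊛ f₂² ⊛ f₂⁻²           ≈⟨ ⊛-congʳ f₂⁻² (pointwise EOᵤ-spec) ⟩
    -- Since 4(t + t²) = (1 + 2t)² - 1, the added multiple of 4 completes f₄² to the square of f₄(1
    -- + 2t).
    f 4 ⊛ f 4 ⊛ f₂⁻²           ≈⟨ 4·-vanish (f 4 ⊛ f 4 ⊛ f₂⁻²) (f 4 ⊛ f 4 ⊛ f₂⁻² ⊛ (t ⊕ t ⊛ t)) ⟨
    f 4 ⊛ f 4 ⊛ f₂⁻² ⊕ const (+ 4) ⊛ (f 4 ⊛ f 4 ⊛ f₂⁻² ⊛ (t ⊕ t ⊛ t))
      ≈⟨ solve 3 (λ x y t → x :* x :* y :+ con (+ 4) :* (x :* x :* y :* (t :+ t :* t))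
           := (x :* (:1 :+ con (+ 2) :* t)) :* (x :* (:1 :+ con (+ 2) :* t)) :* y) ~-refl (f 4) f₂⁻² t ⟩
    (f 4 ⊛ (q^ 0 ⊕ const (+ 2) ⊛ t)) ⊛ (f 4 ⊛ (q^ 0 ⊕ const (+ 2) ⊛ t)) ⊛ f₂⁻²
      ≈⟨ ⊛-congʳ f₂⁻² (⊛-cong~ (f²-mod-4 2) (f²-mod-4 2)) ⟨
    f₂² ⊛ f₂² ⊛ f₂⁻²           ≈⟨ solve 2 (λ x y → x :* x :* y := x :* (y :* x)) ~-refl f₂² f₂⁻² ⟩
    f₂² ⊛ (f₂⁻² ⊛ f₂²)         ≈⟨ ⊛-congˡ f₂² (pointwise (÷-⊛ (q^ 0) f₂² refl)) ⟩
    f₂² ⊛ q^ 0                 ≈⟨ solve 1 (λ x → x :* :1 := x) ~-refl f₂² ⟩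
    f₂²                        ∎
    where
    f₂² f₂⁻² t : Series
    f₂² = f 2 ⊛ f 2
    f₂⁻² = q^ 0 ÷ f₂²
    t = squares 2

  vanishing-coefficient : ∀ {A F} → EOᵤ ~ F → Supp A F → ¬ A w → + 4 ∣ EOᵤ w
  vanishing-coefficient EO~F sF ¬A with sF w
  ... | inj₂ a = contradiction a ¬A
  ... | inj₁ x = ∣.∣⇒∣ᵤ (subst (+ 4 ∣ₛ_)
          (trans (cong (λ z → EOᵤ w -ᶻ z) x) (ℤ.+-identityʳ (EOᵤ w))) (at EO~F w ℕ.≤-refl))

  squares-supp : Supp (λ n → ∃[ t ] 2 * (t * t) ≡ n) (q^ 0 ⊕ const (+ 2) ⊛ squares 2)
  -- The constant term 1 belongs to t = 0.
  squares-supp = ⊕-supp (weaken-supp (0 ,_) (q^-supp 0))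
    (const-⊛-supp (+ 2) (sum-supp w (λ i →
      weaken-supp (λ eq → suc i , trans (sym (ℕ.*-assoc 2 (suc i) (suc i))) eq) (q^-supp _))))

  -- The exponents in f₄(1 + 2 Σ q^2t²) are 4e + 2t² with 24e + 1 = x², and 6(4e + 2t²) + 1 = x² +
  -- 12t².
  4∣EOᵤ-unless-x²+12y² : (∀ x y → x * x + 12 * (y * y) ≢ 6 * w + 1) → + 4 ∣ EOᵤ w
  4∣EOᵤ-unless-x²+12y² no-rep = vanishing-coefficient
    (~-trans EOᵤ~f₂² (~-trans (f²-mod-4 2) (⊛-congʳ (q^ 0 ⊕ const (+ 2) ⊛ squares 2) (f~pentagonal 4))))
    (⊛-supp (pentagonal-supp 4 w) squares-supp)
    λ { (_ , _ , i+j≡w , (e , x , refl , x-eq) , (t , refl)) → no-rep x t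
          (trans (cong (λ z → z + 12 * (t * t)) (sym x-eq)) (trans (lemma e t) (cong (λ z → 6 * z + 1) i+j≡w))) }
    where
    lemma : ∀ e t → 24 * e + 1 + 12 * (t * t) ≡ 6 * (4 * e + 2 * (t * t)) + 1
    lemma = ℕ.solve-∀

  -- The exponents in f₂ f₂ are 2e + 2d with 24e + 1 = x² and 24d + 1 = y², and 12(2e + 2d) + 2 = x²
  -- + y². The coefficient 1 matches the shape of `Anisotropic p 1`.
  4∣EOᵤ-unless-x²+y² : (∀ x y → x * x + 1 * (y * y) ≢ 2 * (6 * w + 1)) → + 4 ∣ EOᵤ w
  4∣EOᵤ-unless-x²+y² no-rep = vanishing-coefficient
    (~-trans EOᵤ~f₂² (⊛-cong~ (f~pentagonal 2) (f~pentagonal 2)))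
    (⊛-supp (pentagonal-supp 2 w) (pentagonal-supp 2 w))
    λ { (_ , _ , i+j≡w , (e , x , refl , x-eq) , (d , y , refl , y-eq)) → no-rep x y
          (trans (cong₂ (λ a b → a + 1 * b) (sym x-eq) (sym y-eq))
                 (trans (lemma e d) (cong (λ z → 2 * (6 * z + 1)) i+j≡w))) }
    where
    lemma : ∀ e d → 24 * e + 1 + 1 * (24 * d + 1) ≡ 2 * (6 * (2 * e + 2 * d) + 1)
    lemma = ℕ.solve-∀

-- Anisotropic binary forms and odd powers of p

Anisotropic : ℕ → ℕ → Set
Anisotropic p c = ∀ x y → p ℕ.∣ x * x + c * (y * y) → p ℕ.∣ x × p ℕ.∣ y

-- The restriction to residues makes the property decidable by finite search.
AnisotropicBelow : ℕ → ℕ → Set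
AnisotropicBelow p c =
  ∀ {a} → a < p → ∀ {b} → b < p → p ℕ.∣ a * a + c * (b * b) → a ≡ 0 × b ≡ 0

anisotropicBelow? : ∀ p c → Dec (AnisotropicBelow p c)
anisotropicBelow? p c = ℕ.allUpTo? (λ a → ℕ.allUpTo? (λ b →
  p ℕ.∣? a * a + c * (b * b) →-dec (a ℕ.≟ 0 ×-dec b ℕ.≟ 0)) p) p

reduce-anisotropic : ∀ p c .{{_ : NonZero p}} → AnisotropicBelow p c → Anisotropic p c
reduce-anisotropic p c below x y p∣ with
  below (ℕ.m%n<n x p) (ℕ.m%n<n y p)
    (ℕ.∣m+n∣m⇒∣n (subst (p ℕ.∣_) residues p∣) (ℕ.n∣m*n (excess (x ℕ.% p) (y ℕ.% p) (x ℕ./ p) (y ℕ./ p))))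
  where
  -- The cofactor of p in the difference between the values of the form at (a + sp, b + tp) and at
  -- (a, b).
  excess : ℕ → ℕ → ℕ → ℕ → ℕ
  excess a b s t = 2 * a * s + s * s * p + c * (2 * b * t + t * t * p)
  lemma : ∀ a b s t c p → (a + s * p) * (a + s * p) + c * ((b + t * p) * (b + t * p))
            ≡ (2 * a * s + s * s * p + c * (2 * b * t + t * t * p)) * p + (a * a + c * (b * b))
  lemma = ℕ.solve-∀
  residues : x * x + c * (y * y) ≡ _
  residues = trans
    (cong₂ (λ x y → x * x + c * (y * y)) (ℕ.m≡m%n+[m/n]*n x p) (ℕ.m≡m%n+[m/n]*n y p))
    (lemma (x ℕ.% p) (y ℕ.% p) (x ℕ./ p) (y ℕ./ p) c p)
... | x≡0 , y≡0 = ℕ.m%n≡0⇒n∣m x p x≡0 , ℕ.m%n≡0⇒n∣m y p y≡0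

-- Descent: anisotropy makes x and y multiples of p, so p² can be divided out and the exponent drops
-- by two. At exponent 1 a factor p survives on the side of the form and would divide u.
odd-power-not-represented : ∀ p c u .{{_ : NonZero p}} → Anisotropic p c → ¬ p ℕ.∣ u →
  ∀ j x y → x * x + c * (y * y) ≢ p ^ suc (2 * j) * u
odd-power-not-represented p c u aniso p∤u j x y eq with
  aniso x y (subst (p ℕ.∣_) (sym (trans eq (ℕ.*-assoc p (p ^ (2 * j)) u))) (ℕ.m∣m*n _))
... | ℕ.divides a refl , ℕ.divides b refl = descend j
  (ℕ.*-cancelˡ-≡ _ _ p (trans (factor a b c p) (trans eq (ℕ.*-assoc p (p ^ (2 * j)) u))))
  where
  factor : ∀ a b c p → p * (p * (a * a + c * (b * b))) ≡ a * p * (a * p) + c * (b * p * (b * p))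
  factor = ℕ.solve-∀
  descend : ∀ j → p * (a * a + c * (b * b)) ≢ p ^ (2 * j) * u
  descend zero    eq = p∤u (subst (p ℕ.∣_) (trans eq (ℕ.*-identityˡ u)) (ℕ.m∣m*n _))
  descend (suc j) eq = odd-power-not-represented p c u aniso p∤u j a b
    (ℕ.*-cancelˡ-≡ _ _ p (trans eq (trans (cong (λ i → p ^ i * u) (ℕ.*-suc 2 j))
                                          (ℕ.*-assoc p (p ^ suc (2 * j)) u))))

-- e is determined by 24 r + 13 = p e and satisfies 24 m + e = 13 p, so that
-- 6 w + 1 = p^(2k-1) (24 (p n + s) + e) at the argument w of EOᵤ.
record Admissible (p r m : ℕ) : Set where
  constructor admissible
  field
    e           : ℕ
    p≥2         : 2 ≤ p
    e-r         : 24 * r + 13 ≡ p * e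
    e-m         : 24 * m + e ≡ 13 * p
    coprime     : ∀ {s} → s < p → s ≢ m → ¬ p ℕ.∣ 2 * (24 * s + e)
    anisotropic : Anisotropic p 12 ⊎ Anisotropic p 1

-- In an admissible triple 24 m + e = 13 p, so s = m has to be excluded; the other residues are
-- tested one by one.
coprime? : ∀ p m e → Dec (∀ {s} → s < p → s ≢ m → ¬ p ℕ.∣ 2 * (24 * s + e))
coprime? p m e = ℕ.allUpTo? (λ s → ¬? (s ℕ.≟ m) →-dec ¬? (p ℕ.∣? 2 * (24 * s + e))) p

anisotropic-by-search : ∀ p c .{{_ : NonZero p}} {_ : True (anisotropicBelow? p c)} → Anisotropic p c
anisotropic-by-search p c {t} = reduce-anisotropic p c (toWitness t)

-- For p ≡ 2 (mod 3), -12 is a nonresidue and the form x² + 12y² serves. The remaining primes 7 and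
-- 19 are 3 modulo 4, so -1 is a nonresidue and x² + y² serves. The first entry is e = (24 r + 13) /
-- p.
triples-admissible : ∀ {p r m} → (p , r , m) ∈ triples → Admissible p r m
triples-admissible (here refl) =
  admissible 17 (s≤s (s≤s z≤n)) refl refl (from-yes (coprime? 5 2 17)) (inj₁ (anisotropic-by-search 5 12))
triples-admissible (there (here refl)) =
  admissible 19 (s≤s (s≤s z≤n)) refl refl (from-yes (coprime? 7 3 19)) (inj₂ (anisotropic-by-search 7 1))
triples-admissible (there (there (here refl))) =
  admissible 23 (s≤s (s≤s z≤n)) refl refl (from-yes (coprime? 11 5 23)) (inj₁ (anisotropic-by-search 11 12))
triples-admissible (there (there (there (here refl)))) =
  admissible 5 (s≤s (s≤s z≤n)) refl refl (from-yes (coprime? 17 9 5)) (inj₁ (anisotropic-by-search 17 12))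
triples-admissible (there (there (there (there (here refl))))) =
  admissible 7 (s≤s (s≤s z≤n)) refl refl (from-yes (coprime? 19 10 7)) (inj₂ (anisotropic-by-search 19 1))
triples-admissible (there (there (there (there (there (here refl)))))) =
  admissible 11 (s≤s (s≤s z≤n)) refl refl (from-yes (coprime? 23 12 11)) (inj₁ (anisotropic-by-search 23 12))
triples-admissible (there (there (there (there (there (there (here refl))))))) =
  admissible 17 (s≤s (s≤s z≤n)) refl refl (from-yes (coprime? 29 15 17)) (inj₁ (anisotropic-by-search 29 12))

-- The value of 6 w + 1 at the argument w of `EOᵤ`

offset-formula : ∀ p r m k e .{{_ : NonZero (p ^ 2 ∸ 1)}} → 2 ≤ p → 1 ≤ k →
  24 * r + 13 ≡ p * e → 24 * m + e ≡ 13 * p →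
  6 * offset p r m k + 1 ≡ p ^ (2 * k ∸ 1) * e
-- Matching `k` as a successor lets `p ^ (2 * k)` compute to `p * q`.
offset-formula p r m k@(suc j) e p≥2 k≥1 e-r e-m =
  ℕ.*-cancelʳ-≡ _ _ d (combine (offset-exact p r m k p≥2 k≥1) e-r e-m p² (identity (offset p r m k) d p r m q e))
  where
  d q : ℕ
  d = p ^ 2 ∸ 1
  q = p ^ (2 * k ∸ 1)
  p² : p ^ 2 ≡ 1 + d
  p² = sym (ℕ.m+[n∸m]≡n (ℕ.≤-trans (s≤s z≤n) (ℕ.^-monoˡ-≤ 2 p≥2)))
  -- A linear certificate for the claim multiplied by d: with Dᵢ = Lᵢ - Rᵢ, A - B = 6 D₁ + (pq - 1)
  -- D₂ + (q - p) D₃ + (qe - 1) D₄. Negative weights are moved across the equation to stay in ℕ.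
  combine : ∀ {A B L₁ R₁ L₂ R₂ L₃ R₃ L₄ R₄} → L₁ ≡ R₁ → L₂ ≡ R₂ → L₃ ≡ R₃ → L₄ ≡ R₄ →
    A + (6 * R₁ + p * q * R₂ + L₂ + q * R₃ + p * L₃ + q * e * R₄ + L₄)
      ≡ B + (6 * L₁ + p * q * L₂ + R₂ + q * L₃ + p * R₃ + q * e * L₄ + R₄) → A ≡ B
  combine refl refl refl refl = ℕ.+-cancelʳ-≡ _ _ _
  identity : ∀ o d p r m q e →
    (6 * o + 1) * d
      + (6 * (4 * (p * q) * r + 4 * q * m + 2 * (p * (p * 1))) + p * q * (p * e) + (24 * r + 13)
         + q * (13 * p) + p * (24 * m + e) + q * e * (1 + d) + p * (p * 1))
    ≡ q * e * d
      + (6 * (o * d + 4 * p * m + 4 * r + 2) + p * q * (24 * r + 13) + p * e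
         + q * (24 * m + e) + p * (13 * p) + q * e * (p * (p * 1)) + (1 + d))
  identity = ℕ.solve-∀

argument-formula : ∀ p r m k e s n .{{_ : NonZero (p ^ 2 ∸ 1)}} → 2 ≤ p → 1 ≤ k →
  24 * r + 13 ≡ p * e → 24 * m + e ≡ 13 * p →
  6 * (4 * p ^ (2 * k) * n + 4 * p ^ (2 * k ∸ 1) * s + offset p r m k) + 1
    ≡ p ^ (2 * k ∸ 1) * (24 * (p * n + s) + e)
argument-formula p r m k@(suc _) e s n p≥2 k≥1 e-r e-m = trans
  (lemma₁ p q n s (offset p r m k))
  (trans (cong (λ z → 24 * (p * q) * n + 24 * q * s + z) (offset-formula p r m k e p≥2 k≥1 e-r e-m))
         (lemma₂ p q n s e))
  where
  q : ℕ
  q = p ^ (2 * k ∸ 1)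
  lemma₁ : ∀ p q n s o → 6 * (4 * (p * q) * n + 4 * q * s + o) + 1 ≡ 24 * (p * q) * n + 24 * q * s + (6 * o + 1)
  lemma₁ = ℕ.solve-∀
  lemma₂ : ∀ p q n s e → 24 * (p * q) * n + 24 * q * s + q * e ≡ q * (24 * (p * n + s) + e)
  lemma₂ = ℕ.solve-∀

corollary4p1 :
    ∀ p r m (h : (p , r , m) ∈ triples) →
    ∀ s → s < p → s ≢ m →
    ∀ n k → 1 ≤ k →
    + 4 ∣ EOᵤ (4 * p ^ (2 * k) * n + 4 * p ^ (2 * k ∸ 1) * s + offset p r m k {{p²-1-nonZero h}})
corollary4p1 p r m h s s<p s≢m n k@(suc j) k≥1 with triples-admissible h
... | admissible e p≥2 e-r e-m coprime anisotropic = by-form anisotropic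
  where
  instance
    _ = p²-1-nonZero h
    _ = >-nonZero (ℕ.≤-trans (s≤s z≤n) p≥2)
  w u : ℕ
  w = 4 * p ^ (2 * k) * n + 4 * p ^ (2 * k ∸ 1) * s + offset p r m k
  u = 24 * (p * n + s) + e

  -- The exponent 2k - 1 is rewritten as 2j + 1, the odd shape on which the descent runs.
  6w+1≡ : 6 * w + 1 ≡ p ^ suc (2 * j) * u
  6w+1≡ = trans (argument-formula p r m k e s n p≥2 k≥1 e-r e-m)
                (cong (λ i → p ^ i * u) (ℕ.+-suc j (j + 0)))

  -- Modulo p, u is 24 s + e. The factor 2 is for x² + y², which has to avoid 2(6 w + 1); for x² +
  -- 12y² it suffices that p ∣ u would imply p ∣ 2u.
  p∤2u : ¬ p ℕ.∣ 2 * u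
  p∤2u p∣2u = coprime s<p s≢m (ℕ.∣m+n∣m⇒∣n (subst (p ℕ.∣_) (lemma p n s e) p∣2u) (ℕ.m∣m*n _))
    where
    lemma : ∀ p n s e → 2 * (24 * (p * n + s) + e) ≡ p * (48 * n) + 2 * (24 * s + e)
    lemma = ℕ.solve-∀

  by-form : Anisotropic p 12 ⊎ Anisotropic p 1 → + 4 ∣ EOᵤ w
  by-form (inj₁ aniso) = 4∣EOᵤ-unless-x²+12y² w λ x y eq →
    odd-power-not-represented p 12 u aniso (p∤2u ∘ ℕ.∣n⇒∣m*n 2) j x y (trans eq 6w+1≡)
  by-form (inj₂ aniso) = 4∣EOᵤ-unless-x²+y² w λ x y eq →
    odd-power-not-represented p 1 (2 * u) aniso p∤2u j x y
      (trans eq (trans (cong (2 *_) 6w+1≡) (lemma (p ^ suc (2 * j)) u)))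
    where
    lemma : ∀ a b → 2 * (a * b) ≡ a * (2 * b)
    lemma = ℕ.solve-∀
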